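{- Let $\mathcal{F}$ be a union-closed family of finite sets with $\emptyset\in\mathcal{F}$ such that every member of $J(\mathcal{F})$ has one or two elements, let $U=\{a,b\}\in J(\mathcal{F})$ with $a\neq b$, and suppose $\mathcal{F}=\mathcal{N}^3_{\mathcal{F}}(U)$. Let $J'(\mathcal{F})=\{V\in J(\mathcal{F}):|V|=2\}$. If for every $V\in J'(\mathcal{F})$ with $V\cap U\neq\emptyset$ we have $d_{J'(\mathcal{F})}(V)\ge d_{J'(\mathcal{F})}(U)$, then for every extension $\mathcal{F}'$ of $(\mathcal{F},U)$, $\mu_{\mathcal{F},\mathcal{F}'}(U)\ge 2$.
   Context: All sets are finite. For families $\mathcal{A},\mathcal{B}$ of sets, $\mathcal{A}\vee\mathcal{B}=\{A\cup B: A\in\mathcal{A},B\in\mathcal{B}\}$, and for a set $Z$, $\mathcal{A}_{\setminus Z}=\{A\setminus Z: A\in\mathcal{A}\}$. $J(\mathcal{F})$ is the set of union generators of $\mathcal{F}$: the nonempty $V\in\mathcal{F}$ not equal to the union of the members of $\mathcal{F}$ properly contained in $V$. For a set $X$, $\pi_{\mathcal{F}}(X)=\bigcup\{V\in\mathcal{F}:V\subseteq X\}$. For a set $W$, $\mathcal{N}_{\mathcal{F}}(W)$ is the family of all unions of subfamilies of $\{V\in J(\mathcal{F}):V\cap W\neq\emptyset\}$ (the empty union being $\emptyset$), and $\mathcal{N}^3_{\mathcal{F}}(U)=\mathcal{N}_{\mathcal{F}}\big(\bigcup\mathcal{N}_{\mathcal{F}}(U)\big)$. A union-closed family $\mathcal{F}'$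 is an extension of $(\mathcal{F},U)$ if $\mathcal{F}'=\mathcal{F}\vee\mathcal{H}$ for some nonempty union-closed family $\mathcal{H}$ with $(\bigcup\mathcal{H})\cap U=\emptyset$. For $X$ with $X\cap U=\emptyset$, $E_{\mathcal{F},U}(X)$ is the set of $Y\subseteq U$ with $\pi_{\mathcal{F}}(X\cup Y)\cap U=Y$ and $\pi_{\mathcal{F}}(X\cup Y)\supseteq\pi_{\mathcal{F}}(X\cup U)\setminus U$. For an extension $\mathcal{F}'$, $\mu_{\mathcal{F},\mathcal{F}'}(U)=\sum_{X\in\mathcal{F}'_{\setminus U}}|E_{\mathcal{F},U}(X)|\,/\,|\mathcal{F}'_{\setminus U}|$. For a family $\mathcal{G}$ and set $V$, $d_{\mathcal{G}}(V)=|\{W\in\mathcal{G}\setminus\{V\}:W\cap V\neq\emptyset\}|$. -}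

module Defs where

open import Data.Nat using (ℕ; zero; suc; _+_; _*_; _≤_; _≡ᵇ_)
open import Data.Bool using (Bool; true; false; _∧_; not; if_then_else_)
import Data.Bool as Bo
open import Data.List using (List; []; _∷_; map; foldr; length; _++_)
open import Data.Bool.ListAction using (any)
open import Data.Nat.ListAction using (sum)
open import Data.Vec using ([]; _∷_)
open import Data.Fin.Subset using (Subset; ⊥; _∪_; _∩_; _─_; ∣_∣; Empty)
open import Data.Fin.Subset.Properties using (_⊆?_; nonempty?)
open import Data.Vec.Properties using (≡-dec)
open import Data.Product using (Σ; _×_)
open import Relation.Nullary.Decidable using (does)
open import Relation.Binary.PropositionalEquality using (_≡_)

Fam : ℕ → Set
Fam n = Subset n → Bool

allSubsets : (n : ℕ) → List (Subset n)
allSubsets zero = [] ∷ []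
allSubsets (suc n) = map (true ∷_) (allSubsets n) ++ map (false ∷_) (allSubsets n)

filterB : {A : Set} → (A → Bool) → List A → List A
filterB p [] = []
filterB p (x ∷ xs) = if p x then x ∷ filterB p xs else filterB p xs

sublists : {A : Set} → List A → List (List A)
sublists [] = [] ∷ []
sublists (x ∷ xs) = sublists xs ++ map (x ∷_) (sublists xs)

module _ {n : ℕ} where

  _==_ : Subset n → Subset n → Bool
  A == B = does (≡-dec Bo._≟_ A B)

  _⊆ᵇ_ : Subset n → Subset n → Bool
  A ⊆ᵇ B = does (A ⊆? B)

  nonemptyᵇ : Subset n → Bool
  nonemptyᵇ A = does (nonempty? A)

  members : Fam n → List (Subset n)
  members F = filterB F (allSubsets n)

  card : Fam n → ℕ
  card F = length (members F)

  ⋃ : List (Subset n) → Subset n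
  ⋃ = foldr _∪_ ⊥

  ⋃F : Fam n → Subset n
  ⋃F F = ⋃ (members F)

  UnionClosed : Fam n → Set
  UnionClosed F = ∀ A B → F A ≡ true → F B ≡ true → F (A ∪ B) ≡ true

  NonemptyFam : Fam n → Set
  NonemptyFam F = Σ (Subset n) λ A → F A ≡ true

  _∨F_ : Fam n → Fam n → Fam n
  (F ∨F H) X = any (λ A → any (λ B → X == (A ∪ B)) (members H)) (members F)

  _∖F_ : Fam n → Subset n → Fam n
  (F ∖F Z) Y = any (λ X → Y == (X ─ Z)) (members F)

  J : Fam n → Fam n
  J F V = F V ∧ nonemptyᵇ V ∧
          not (V == ⋃ (filterB (λ W → (W ⊆ᵇ V) ∧ not (W == V)) (members F)))

  J′ : Fam n → Fam n
  J′ F V = J F V ∧ (∣ V ∣ ≡ᵇ 2)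

  π : Fam n → Subset n → Subset n
  π F X = ⋃ (filterB (λ V → V ⊆ᵇ X) (members F))

  N : Fam n → Subset n → Fam n
  N F W X = any (λ S → X == ⋃ S)
                (sublists (filterB (λ V → J F V ∧ nonemptyᵇ (V ∩ W)) (allSubsets n)))

  N³ : Fam n → Subset n → Fam n
  N³ F U = N F (⋃F (N F U))

  IsExtension : Fam n → Subset n → Fam n → Set
  IsExtension F U F′ =
    UnionClosed F′ ×
    Σ (Fam n) λ H → UnionClosed H × NonemptyFam H × Empty (⋃F H ∩ U) ×
                    (∀ X → F′ X ≡ (F ∨F H) X)

  Eᵇ : Fam n → Subset n → Subset n → Subset n → Bool
  Eᵇ F U X Y = (Y ⊆ᵇ U) ∧ ((π F (X ∪ Y) ∩ U) == Y) ∧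
               ((π F (X ∪ U) ─ U) ⊆ᵇ π F (X ∪ Y))

  Ecard : Fam n → Subset n → Subset n → ℕ
  Ecard F U X = length (filterB (Eᵇ F U X) (allSubsets n))

  μnum : Fam n → Fam n → Subset n → ℕ
  μnum F F′ U = sum (map (Ecard F U) (members (F′ ∖F U)))

  μden : Fam n → Fam n → Subset n → ℕ
  μden F F′ U = card (F′ ∖F U)

  deg : Fam n → Subset n → ℕ
  deg G V = length (filterB (λ W → not (W == V) ∧ nonemptyᵇ (W ∩ V)) (members G))

{-# OPTIONS --safe #-}
module Submission where

-- Regard J(F) as a graph with loops and call x ∈ X covered if x ∈ π_F(X), that is, if some edge
-- inside X contains x. Let A be the set of loopless neighbours of a outside U that are not neighbours
-- of b, and B the same with a and b exchanged. Let M consist of the X in the trace of F′ outside U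
-- with a ∈ π(X ∪ {a}) and b ∈ π(X ∪ {b}). Then |E(X)| ≥ 1 always, |E(X)| ≥ 2 unless X ∈ M and both A
-- and B have an uncovered vertex in X, and |E(X)| ≥ 3 if X ∈ M and neither has one. Hence it suffices
-- that #{X ∈ M : A covered} + #{X ∈ M : B covered} ≥ |M|.
--
-- Let p and q be the numbers of two-element generators containing a but not b, resp. b but not a. Then
-- |A| ≤ p, |B| ≤ q, and the degree hypothesis gives each x ∈ A at least q neighbours outside U, and
-- each y ∈ B at least p. M is closed under adding neighbours of present vertices, so at most a fraction
-- 2^-q of it leaves a given x ∈ A uncovered; the members of M in which x is absent or covered are again
-- closed in this sense, so iterating over A, a fraction at least (1 - 2^-q)^p of M covers A. The same
-- holds for B, and (1 - 2^-q)^p + (1 - 2^-p)^q ≥ 1.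

open import Defs
open import Data.Nat using (_≡ᵇ_; ℕ; zero; suc; _+_; _*_; _∸_; _^_; _≤_; z≤n; s≤s)
open import Data.Nat.Properties
open import Data.Nat.Tactic.RingSolver using (solve-∀)
open import Data.Nat.ListAction using (sum)
open import Data.Bool using (Bool; true; false; _∧_; _∨_; not; if_then_else_)
import Data.Bool as Bo
open import Data.Bool.Properties using (∧-assoc)
open import Data.Bool.ListAction using (any; all)
open import Data.Fin using (Fin)
open import Data.Fin.Subset using (Subset; ⊥; ⁅_⁆; _∪_; _∩_; _─_; ∣_∣; Nonempty; _∈_; _∉_; _⊆_)
open import Data.Fin.Subset.Properties
open import Data.List using (List; []; _∷_; map; length; _++_; [_]; allFin)
open import Data.List.Properties using (length-++)
open import Data.List.Membership.Propositional using () renaming (_∈_ to _∈ₗ_)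
open import Data.List.Membership.Propositional.Properties using (∈-∃++; ∈-++⁺ˡ; ∈-++⁺ʳ; ∈-++⁻; ∈-map⁺; ∈-map⁻; ∈-allFin)
open import Data.List.Relation.Unary.Any using (here; there)
open import Data.List.Relation.Unary.All using ([]; _∷_)
import Data.List.Relation.Unary.All as All
open import Data.List.Relation.Unary.AllPairs using ([]; _∷_)
open import Data.List.Relation.Unary.Unique.Propositional using (Unique)
open import Data.List.Relation.Unary.Unique.Propositional.Properties using (map⁺; ++⁺; allFin⁺)
open import Data.List.Relation.Binary.Disjoint.Propositional using (Disjoint)
open import Data.Product using (∃-syntax; _×_; _,_; proj₁; proj₂)
open import Data.Sum using (_⊎_; inj₁; inj₂; [_,_]′)
open import Data.Vec using ([]; _∷_)
import Data.Vec.Properties as Vec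
open import Function using (_∘_; id; case_of_)
open import Relation.Nullary using (¬_; Dec; yes; no; contradiction; does)
open import Relation.Nullary.Decidable using (dec-true; dec-false)
open import Relation.Binary.PropositionalEquality using (_≡_; _≢_; refl; sym; trans; cong; subst; module ≡-Reasoning)

-- Booleans, filters and counting along lists.

private variable
  A B : Set

does⁻ : (d : Dec A) → does d ≡ true → A
does⁻ (yes a) _ = a

does-no : (d : Dec A) → does d ≡ false → ¬ A
does-no (no ¬a) _ = ¬a

∧⁺ : ∀ {x y} → x ≡ true → y ≡ true → x ∧ y ≡ true
∧⁺ refl refl = refl

∧⁻ : ∀ {x y} → x ∧ y ≡ true → x ≡ true × y ≡ true
∧⁻ {true} {true} _ = refl , refl

not⁻ : ∀ {x} → not x ≡ true → x ≡ false
not⁻ {false} _ = refl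

any⁺ : (p : A → Bool) {xs : List A} {x : A} → x ∈ₗ xs → p x ≡ true → any p xs ≡ true
any⁺ p (here refl) px rewrite px = refl
any⁺ p {y ∷ _} (there x∈) px with p y
... | true = refl
... | false = any⁺ p x∈ px

any⁻ : (p : A → Bool) (xs : List A) → any p xs ≡ true → ∃[ x ] x ∈ₗ xs × p x ≡ true
any⁻ p (x ∷ xs) eq with p x in px
... | true = x , here refl , px
... | false with any⁻ p xs eq
...   | y , y∈ , py = y , there y∈ , py

filterB⁺ : (p : A → Bool) {xs : List A} {x : A} → x ∈ₗ xs → p x ≡ true → x ∈ₗ filterB p xs
filterB⁺ p (here refl) px rewrite px = here refl
filterB⁺ p {y ∷ _} (there x∈) px with p y
... | true = there (filterB⁺ p x∈ px)
... | false = filterB⁺ p x∈ px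

filterB⁻ : (p : A → Bool) (xs : List A) {x : A} → x ∈ₗ filterB p xs → x ∈ₗ xs × p x ≡ true
filterB⁻ p (y ∷ xs) x∈ with p y in py
filterB⁻ p (y ∷ xs) (here refl) | true = here refl , py
filterB⁻ p (y ∷ xs) (there x∈) | true with filterB⁻ p xs x∈
... | x∈xs , px = there x∈xs , px
filterB⁻ p (y ∷ xs) x∈ | false with filterB⁻ p xs x∈
... | x∈xs , px = there x∈xs , px

filterB-unique : (p : A → Bool) {xs : List A} → Unique xs → Unique (filterB p xs)
filterB-unique p {[]} _ = []
filterB-unique p {x ∷ xs} (x∉ ∷ u) with p x
... | true = All.tabulate (λ y∈ → All.lookup x∉ (proj₁ (filterB⁻ p xs y∈))) ∷ filterB-unique p u
... | false = filterB-unique p u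

filterB-filterB : (p q : A → Bool) (xs : List A) → filterB q (filterB p xs) ≡ filterB (λ x → p x ∧ q x) xs
filterB-filterB p q [] = refl
filterB-filterB p q (x ∷ xs) with p x
... | false = filterB-filterB p q xs
... | true with q x
...   | true = cong (x ∷_) (filterB-filterB p q xs)
...   | false = filterB-filterB p q xs

-- A relation in place of a map lets R carry side conditions for injectivity to use. Delete one
-- occurrence of the partner of the head from `ys`; later elements keep theirs, since sharing it
-- would make them equal to the head, against uniqueness.
pigeonhole : (R : A → B → Set) (xs : List A) (ys : List B) → Unique xs →
  (∀ {x} → x ∈ₗ xs → ∃[ y ] y ∈ₗ ys × R x y) →
  (∀ {x x′ y} → R x y → R x′ y → x ≡ x′) → length xs ≤ length ys
pigeonhole R [] ys _ _ _ = z≤n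
pigeonhole R (x ∷ xs) ys (x∉ ∷ u) tot inj with tot (here refl)
... | y , y∈ , Rxy with ∈-∃++ y∈
...   | as , bs , refl = begin
  suc (length xs)              ≤⟨ s≤s (pigeonhole R xs (as ++ bs) u tot′ inj) ⟩
  suc (length (as ++ bs))      ≡⟨ cong suc (length-++ as) ⟩
  suc (length as + length bs)  ≡⟨ +-suc (length as) (length bs) ⟨
  length as + suc (length bs)  ≡⟨ length-++ as ⟨
  length (as ++ y ∷ bs)        ∎
  where
  open ≤-Reasoning
  tot′ : ∀ {x′} → x′ ∈ₗ xs → ∃[ y′ ] y′ ∈ₗ as ++ bs × R x′ y′
  tot′ x′∈ with tot (there x′∈)
  ... | y′ , y′∈ , Rx′y′ with ∈-++⁻ as y′∈
  ...   | inj₁ y′∈as = y′ , ∈-++⁺ˡ y′∈as , Rx′y′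
  ...   | inj₂ (here refl) = contradiction (inj Rxy Rx′y′) (All.lookup x∉ x′∈)
  ...   | inj₂ (there y′∈bs) = y′ , ∈-++⁺ʳ as y′∈bs , Rx′y′

unique-⊆-length : {xs ys : List A} → Unique xs → (∀ {x} → x ∈ₗ xs → x ∈ₗ ys) → length xs ≤ length ys
unique-⊆-length {xs = xs} {ys} u sub =
  pigeonhole _≡_ xs ys u (λ x∈ → _ , sub x∈ , refl) (λ { refl refl → refl })

count : (A → Bool) → List A → ℕ
count p xs = length (filterB p xs)

count-pigeonhole : (R : A → B → Set) (p : A → Bool) (q : B → Bool) (xs : List A) (ys : List B) → Unique xs →
  (∀ x → p x ≡ true → ∃[ y ] y ∈ₗ ys × q y ≡ true × R x y) →
  (∀ {x x′ y} → R x y → R x′ y → x ≡ x′) → count p xs ≤ count q ys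
count-pigeonhole R p q xs ys u tot inj = pigeonhole R (filterB p xs) (filterB q ys) (filterB-unique p u)
  (λ x∈ → let y , y∈ , qy , Rxy = tot _ (proj₂ (filterB⁻ p xs x∈)) in y , filterB⁺ q y∈ qy , Rxy) inj

𝟙 : Bool → ℕ
𝟙 b = if b then 1 else 0

𝟙≤1 : ∀ b → 𝟙 b ≤ 1
𝟙≤1 true = ≤-refl
𝟙≤1 false = z≤n

count≡sum : (p : A → Bool) (xs : List A) → count p xs ≡ sum (map (𝟙 ∘ p) xs)
count≡sum p [] = refl
count≡sum p (x ∷ xs) with p x
... | true = cong suc (count≡sum p xs)
... | false = count≡sum p xs

sum-map-+ : (f g : A → ℕ) (xs : List A) → sum (map f xs) + sum (map g xs) ≡ sum (map (λ x → f x + g x) xs)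
sum-map-+ f g [] = refl
sum-map-+ f g (x ∷ xs) = trans (lem (f x) _ (g x) _) (cong (f x + g x +_) (sum-map-+ f g xs))
  where
  lem : ∀ a b c d → (a + b) + (c + d) ≡ (a + c) + (b + d)
  lem = solve-∀

sum-map-mono : (f g : A → ℕ) (xs : List A) → (∀ x → x ∈ₗ xs → f x ≤ g x) → sum (map f xs) ≤ sum (map g xs)
sum-map-mono f g [] _ = z≤n
sum-map-mono f g (x ∷ xs) le = +-mono-≤ (le x (here refl)) (sum-map-mono f g xs (λ y y∈ → le y (there y∈)))

count-mono : (p q : A → Bool) (xs : List A) → (∀ x → p x ≡ true → q x ≡ true) → count p xs ≤ count q xs
count-mono p q xs imp rewrite count≡sum p xs | count≡sum q xs = sum-map-mono _ _ xs (λ x _ → le x)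
  where
  le : ∀ x → 𝟙 (p x) ≤ 𝟙 (q x)
  le x with p x in px
  ... | true rewrite imp x px = ≤-refl
  ... | false = z≤n

count-split : (p q : A → Bool) (xs : List A) →
  count p xs ≡ count (λ x → p x ∧ q x) xs + count (λ x → p x ∧ not (q x)) xs
count-split p q [] = refl
count-split p q (x ∷ xs) with p x | q x
... | false | _ = count-split p q xs
... | true | true = cong suc (count-split p q xs)
... | true | false = trans (cong suc (count-split p q xs)) (sym (+-suc _ _))

-- Enumeration of the subsets.

allSubsets-complete : ∀ {n} (X : Subset n) → X ∈ₗ allSubsets n
allSubsets-complete [] = here refl
allSubsets-complete (true ∷ X) = ∈-++⁺ˡ (∈-map⁺ (true ∷_) (allSubsets-complete X))
allSubsets-complete (false ∷ X) = ∈-++⁺ʳ _ (∈-map⁺ (false ∷_) (allSubsets-complete X))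

allSubsets-unique : ∀ n → Unique (allSubsets n)
allSubsets-unique zero = [] ∷ []
allSubsets-unique (suc n) = ++⁺ (map⁺ Vec.∷-injectiveʳ u) (map⁺ Vec.∷-injectiveʳ u) disj
  where
  u = allSubsets-unique n
  disj : Disjoint (map (true ∷_) (allSubsets n)) (map (false ∷_) (allSubsets n))
  disj (t , f) with ∈-map⁻ (true ∷_) t | ∈-map⁻ (false ∷_) f
  ... | _ , _ , refl | _ , _ , ()

∈-filter-all : ∀ {n} (p : Subset n → Bool) {X} → p X ≡ true → X ∈ₗ filterB p (allSubsets n)
∈-filter-all p = filterB⁺ p (allSubsets-complete _)

∪⁅⁆-cancel : ∀ {n} {X Y : Subset n} {z} → z ∉ X → z ∉ Y → X ∪ ⁅ z ⁆ ≡ Y ∪ ⁅ z ⁆ → X ≡ Y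
∪⁅⁆-cancel {z = z} z∉X z∉Y eq = ⊆-antisym (half z∉X eq) (half z∉Y (sym eq))
  where
  half : ∀ {X Y} → z ∉ X → X ∪ ⁅ z ⁆ ≡ Y ∪ ⁅ z ⁆ → X ⊆ Y
  half {X} {Y} z∉X eq {v} v∈ with x∈p∪q⁻ Y ⁅ z ⁆ (subst (v ∈_) eq (p⊆p∪q ⁅ z ⁆ v∈))
  ... | inj₁ v∈Y = v∈Y
  ... | inj₂ v∈z with refl ← x∈⁅y⁆⇒x≡y z v∈z = contradiction v∈ z∉X

-- Families of sets closed under adding vertices.

module _ {n : ℕ} where

  #_ : (Subset n → Bool) → ℕ
  # p = count p (allSubsets n)

  #-avoiding : (P : Subset n → Bool) (z : Fin n) → (∀ X → P X ≡ true → P (X ∪ ⁅ z ⁆) ≡ true) →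
    2 * # (λ X → P X ∧ not (does (z ∈? X))) ≤ # P
  #-avoiding P z cl = begin
    2 * c        ≡⟨ cong (c +_) (+-identityʳ c) ⟩
    c + c        ≤⟨ +-monoˡ-≤ c inj ⟩
    # (λ X → P X ∧ does (z ∈? X)) + c  ≡⟨ count-split P (λ X → does (z ∈? X)) (allSubsets n) ⟨
    # P          ∎
    where
    open ≤-Reasoning
    c = # (λ X → P X ∧ not (does (z ∈? X)))
    -- Adding z maps the members of P that avoid z injectively to members of P that contain z.
    inj = count-pigeonhole (λ X Y → Y ≡ X ∪ ⁅ z ⁆ × z ∉ X) _ _ (allSubsets n) (allSubsets n) (allSubsets-unique n)
      (λ X pX → let PX , z∉ = ∧⁻ pX in
        X ∪ ⁅ z ⁆ , allSubsets-complete _ ,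
        ∧⁺ (cl X PX) (dec-true (z ∈? _) (q⊆p∪q X ⁅ z ⁆ (x∈⁅x⁆ z))) ,
        refl , does-no (z ∈? X) (not⁻ z∉))
      (λ { (refl , z∉X) (eq , z∉Y) → ∪⁅⁆-cancel z∉X z∉Y eq })

  #-avoiding-list : (zs : List (Fin n)) → Unique zs → (P Q : Subset n → Bool) →
    (∀ X z → z ∈ₗ zs → P X ≡ true → P (X ∪ ⁅ z ⁆) ≡ true) →
    (∀ X → Q X ≡ true → P X ≡ true × (∀ z → z ∈ₗ zs → z ∉ X)) →
    2 ^ length zs * # Q ≤ # P
  #-avoiding-list [] _ P Q _ imp =
    subst (_≤ # P) (sym (+-identityʳ (# Q))) (count-mono Q P (allSubsets n) (λ X → proj₁ ∘ imp X))
  #-avoiding-list (z ∷ zs) (z∉zs ∷ u) P Q cl imp = begin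
    2 * 2 ^ length zs * # Q   ≡⟨ *-assoc 2 (2 ^ length zs) (# Q) ⟩
    2 * (2 ^ length zs * # Q) ≤⟨ *-monoʳ-≤ 2 (#-avoiding-list zs u P′ Q cl′ imp′) ⟩
    2 * # P′                  ≤⟨ #-avoiding P z (λ X → cl X z (here refl)) ⟩
    # P                       ∎
    where
    open ≤-Reasoning
    -- Each listed vertex halves the family. Avoiding z survives the addition of later vertices
    -- because the list has no repetitions, so the induction continues with P′.
    P′ : Subset n → Bool
    P′ X = P X ∧ not (does (z ∈? X))
    cl′ : ∀ X w → w ∈ₗ zs → P′ X ≡ true → P′ (X ∪ ⁅ w ⁆) ≡ true
    cl′ X w w∈ PX with ∧⁻ PX
    ... | PX′ , z∉ = ∧⁺ (cl X w (there w∈) PX′) (cong not (dec-false (z ∈? _) z∉′))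
      where
      z∉′ : z ∉ X ∪ ⁅ w ⁆
      z∉′ z∈ with x∈p∪q⁻ X ⁅ w ⁆ z∈
      ... | inj₁ z∈X = does-no (z ∈? X) (not⁻ z∉) z∈X
      ... | inj₂ z∈w = All.lookup z∉zs w∈ (x∈⁅y⁆⇒x≡y w z∈w)
    imp′ : ∀ X → Q X ≡ true → P′ X ≡ true × (∀ w → w ∈ₗ zs → w ∉ X)
    imp′ X QX with imp X QX
    ... | PX , av = ∧⁺ PX (cong not (dec-false (z ∈? X) (av z (here refl)))) , λ w w∈ → av w (there w∈)

-- The numerical inequality

-- Passing from n to n + 1 multiplies the sides by 2(n + 1)/n and by 3, which preserves the
-- inequality from n = 2 on; smaller n are checked directly.
n*2^n≤3^n : ∀ n → n * 2 ^ n ≤ 3 ^ n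
n*2^n≤3^n 0 = z≤n
n*2^n≤3^n 1 = s≤s (s≤s z≤n)
n*2^n≤3^n (suc (suc k)) = from2 k
  where
  open ≤-Reasoning
  lhs : ∀ k P → (3 + k) * (2 * P) ≡ 6 * P + 2 * (k * P)
  lhs = solve-∀
  rhs : ∀ k P → 3 * ((2 + k) * P) ≡ 6 * P + 3 * (k * P)
  rhs = solve-∀
  from2 : ∀ k → (2 + k) * 2 ^ (2 + k) ≤ 3 ^ (2 + k)
  from2 zero = n≤1+n 8
  from2 (suc k) = begin
    (3 + k) * (2 * P)      ≡⟨ lhs k P ⟩
    6 * P + 2 * (k * P)    ≤⟨ +-monoʳ-≤ (6 * P) (*-monoˡ-≤ (k * P) (n≤1+n 2)) ⟩
    6 * P + 3 * (k * P)    ≡⟨ rhs k P ⟨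
    3 * ((2 + k) * P)      ≤⟨ *-monoʳ-≤ 3 (from2 k) ⟩
    3 * 3 ^ (2 + k)        ∎
    where P = 2 ^ (2 + k)

-- Bernoulli's inequality (1 - 1/(r+1))^(p+1) ≥ 1 - (p+1)/(r+1), with denominators cleared.
bernoulli : ∀ r p → suc r ^ suc p ≤ r ^ suc p + suc p * suc r ^ p
bernoulli r zero = ≤-reflexive (base r)
  where
  base : ∀ r → (1 + r) * 1 ≡ r * 1 + 1
  base = solve-∀
bernoulli r (suc p) = begin
  S + r * S                      ≤⟨ +-monoʳ-≤ S (*-monoʳ-≤ r (bernoulli r p)) ⟩
  S + r * (r ^ suc p + suc p * T)  ≡⟨ lem S r (r ^ suc p) (suc p) T ⟩
  r * r ^ suc p + (S + suc p * (r * T))  ≤⟨ +-monoʳ-≤ (r * r ^ suc p) (+-monoʳ-≤ S (*-monoʳ-≤ (suc p) (m≤n+m (r * T) T))) ⟩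
  r * r ^ suc p + (S + suc p * S)  ∎
  where
  open ≤-Reasoning
  S = suc r ^ suc p
  T = suc r ^ p
  lem : ∀ S r R p T → S + r * (R + p * T) ≡ r * R + (S + p * (r * T))
  lem = solve-∀

^-distribʳ-* : ∀ a b n → (a * b) ^ n ≡ a ^ n * b ^ n
^-distribʳ-* a b zero = refl
^-distribʳ-* a b (suc n) = trans (cong (a * b *_) (^-distribʳ-* a b n)) ([m*n]*[o*p]≡[m*o]*[n*p] a b (a ^ n) (b ^ n))

^-swap : ∀ m p q → (m ^ p) ^ q ≡ (m ^ q) ^ p
^-swap m p q = begin
  (m ^ p) ^ q  ≡⟨ ^-*-assoc m p q ⟩
  m ^ (p * q)  ≡⟨ cong (m ^_) (*-comm p q) ⟩
  m ^ (q * p)  ≡⟨ ^-*-assoc m q p ⟨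
  (m ^ q) ^ p  ∎
  where open ≡-Reasoning

-- With P = p + 1 this is P 2^-q ≤ (1 - 2^-P)^q, which pays for the loss in `bernoulli`. For P ≥ 2
-- it combines P ≤ q, q 2^q ≤ 3^q and 3 · 2^(P-2) ≤ 2^P - 1.
p*2^q^p-1≤[2^p-1]^q : ∀ p q → suc p ≤ q → suc p * (2 ^ q) ^ p ≤ (2 ^ suc p ∸ 1) ^ q
p*2^q^p-1≤[2^p-1]^q zero q _ = ≤-reflexive (sym (^-zeroˡ q))
p*2^q^p-1≤[2^p-1]^q (suc k) q p≤q = begin
  (2 + k) * (2 ^ q * (2 ^ q) ^ k)  ≤⟨ *-monoˡ-≤ (2 ^ q * (2 ^ q) ^ k) p≤q ⟩
  q * (2 ^ q * (2 ^ q) ^ k)        ≡⟨ *-assoc q (2 ^ q) ((2 ^ q) ^ k) ⟨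
  q * 2 ^ q * (2 ^ q) ^ k          ≤⟨ *-monoˡ-≤ ((2 ^ q) ^ k) (n*2^n≤3^n q) ⟩
  3 ^ q * (2 ^ q) ^ k              ≡⟨ cong (3 ^ q *_) (^-swap 2 q k) ⟩
  3 ^ q * (2 ^ k) ^ q              ≡⟨ ^-distribʳ-* 3 (2 ^ k) q ⟨
  (3 * 2 ^ k) ^ q                  ≤⟨ ^-monoˡ-≤ q 3*2^k≤ ⟩
  (2 ^ (2 + k) ∸ 1) ^ q            ∎
  where
  open ≤-Reasoning
  four : ∀ x → 3 * suc x + 1 + x ≡ 2 * (2 * suc x)
  four = solve-∀
  3*2^k≤ : 3 * 2 ^ k ≤ 2 ^ (2 + k) ∸ 1
  3*2^k≤ with 2 ^ k | m^n>0 2 k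
  -- With 2^k = x + 1 the claim is 3(x + 1) ≤ 4(x + 1) - 1.
  ... | suc x | _ = m+n≤o⇒m≤o∸n (3 * suc x) (≤-trans (m≤m+n _ x) (≤-reflexive (four x)))

-- Divided by 2^(pq): (1 - 2^-q)^p + (1 - 2^-p)^q ≥ 1.
2^pq≤[2^q-1]^p+[2^p-1]^q : ∀ p q → (2 ^ p) ^ q ≤ (2 ^ q ∸ 1) ^ p + (2 ^ p ∸ 1) ^ q
2^pq≤[2^q-1]^p+[2^p-1]^q p q = [ ordered p q , flipped ]′ (≤-total p q)
  where
  open ≤-Reasoning
  ordered : ∀ p q → p ≤ q → (2 ^ p) ^ q ≤ (2 ^ q ∸ 1) ^ p + (2 ^ p ∸ 1) ^ q
  ordered zero q _ = ≤-trans (≤-reflexive (^-zeroˡ q)) (m≤m+n 1 _)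
  -- Bernoulli with r + 1 = 2^q leaves (p + 1)(2^q)^p to be bounded, and p + 1 ≤ q makes this at
  -- most the second summand.
  ordered (suc p) q p<q = begin
    (2 ^ suc p) ^ q                                  ≡⟨ ^-swap 2 (suc p) q ⟩
    (2 ^ q) ^ suc p                                  ≡⟨ cong (_^ suc p) r+1 ⟨
    suc r ^ suc p                                    ≤⟨ bernoulli r p ⟩
    r ^ suc p + suc p * suc r ^ p                    ≡⟨ cong (λ s → r ^ suc p + suc p * s ^ p) r+1 ⟩
    r ^ suc p + suc p * (2 ^ q) ^ p                  ≤⟨ +-monoʳ-≤ (r ^ suc p) (p*2^q^p-1≤[2^p-1]^q p q p<q) ⟩
    r ^ suc p + (2 ^ suc p ∸ 1) ^ q                  ∎
    where
    r = 2 ^ q ∸ 1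
    r+1 : suc r ≡ 2 ^ q
    r+1 = m+[n∸m]≡n (m^n>0 2 q)
  flipped : q ≤ p → (2 ^ p) ^ q ≤ (2 ^ q ∸ 1) ^ p + (2 ^ p ∸ 1) ^ q
  flipped q≤p = begin
    (2 ^ p) ^ q                      ≡⟨ ^-swap 2 p q ⟩
    (2 ^ q) ^ p                      ≤⟨ ordered q p q≤p ⟩
    (2 ^ p ∸ 1) ^ q + (2 ^ q ∸ 1) ^ p  ≡⟨ +-comm ((2 ^ p ∸ 1) ^ q) _ ⟩
    (2 ^ q ∸ 1) ^ p + (2 ^ p ∸ 1) ^ q  ∎

-- Counting the sets that leave no listed vertex isolated

module _ {n : ℕ} (cov : Fin n → Subset n → Bool) (nbrs : Fin n → List (Fin n)) where

  fine : Fin n → Subset n → Bool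
  fine x X = not (does (x ∈? X)) ∨ cov x X

  fine⁺ : ∀ {x X} → (x ∈ X → cov x X ≡ true) → fine x X ≡ true
  fine⁺ {x} {X} c with x ∈? X
  ... | yes x∈X = c x∈X
  ... | no _ = refl

  fine⁻ : ∀ {x X} → fine x X ≡ true → x ∈ X → cov x X ≡ true
  fine⁻ {x} {X} f x∈X with x ∈? X
  ... | yes _ = f
  ... | no x∉X = contradiction x∈X x∉X

  #-all-fine :
    (∀ x X z → cov x X ≡ true → cov x (X ∪ ⁅ z ⁆) ≡ true) →
    (∀ x X z → z ∈ₗ nbrs x → x ∈ X → z ∈ X → cov x X ≡ true × cov z X ≡ true) →
    ∀ q xs → (∀ x → x ∈ₗ xs → Unique (nbrs x) × q ≤ length (nbrs x)) →
    (M : Subset n → Bool) →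
    (∀ X x z → x ∈ₗ xs → x ∈ X → z ∈ₗ nbrs x → M X ≡ true → M (X ∪ ⁅ z ⁆) ≡ true) →
    (2 ^ q ∸ 1) ^ length xs * # M ≤ (2 ^ q) ^ length xs * # (λ X → M X ∧ all (λ x → fine x X) xs)
  #-all-fine mono edge q [] deg M cl =
    *-monoʳ-≤ 1 (count-mono M _ (allSubsets n) (λ X MX → ∧⁺ MX refl))
  #-all-fine mono edge q (x ∷ xs) deg M cl = begin
    -- Induction on the list: making x fine keeps a fraction of at least 1 - 2^-q of M, and the
    -- family M′ of remaining sets satisfies the same closure hypothesis for `xs`.
    r * r ^ l * # M               ≡⟨ l₁ r (r ^ l) (# M) ⟩
    r ^ l * (r * # M)             ≤⟨ *-monoʳ-≤ (r ^ l) step ⟩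
    r ^ l * (2 ^ q * # M′)        ≡⟨ l₂ (r ^ l) (2 ^ q) (# M′) ⟩
    2 ^ q * (r ^ l * # M′)        ≤⟨ *-monoʳ-≤ (2 ^ q) (#-all-fine mono edge q xs (λ y → deg y ∘ there) M′ cl′) ⟩
    2 ^ q * ((2 ^ q) ^ l * # N′)  ≡⟨ *-assoc (2 ^ q) ((2 ^ q) ^ l) (# N′) ⟨
    2 ^ q * (2 ^ q) ^ l * # N′    ≤⟨ *-monoʳ-≤ (2 ^ q * (2 ^ q) ^ l) (count-mono N′ _ (allSubsets n) (λ X NX → trans (sym (∧-assoc (M X) _ _)) NX)) ⟩
    2 ^ q * (2 ^ q) ^ l * # (λ X → M X ∧ all (λ x → fine x X) (x ∷ xs)) ∎
    where
    open ≤-Reasoning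
    r = 2 ^ q ∸ 1
    l = length xs
    M′ N′ P Q : Subset n → Bool
    M′ X = M X ∧ fine x X
    N′ X = M′ X ∧ all (λ x → fine x X) xs
    P X = M X ∧ does (x ∈? X)
    Q X = M X ∧ not (fine x X)
    l₁ : ∀ a b c → a * b * c ≡ b * (a * c)
    l₁ = solve-∀
    l₂ : ∀ a b c → a * (b * c) ≡ b * (a * c)
    l₂ = solve-∀

    isolated : ∀ {x X} → not (fine x X) ≡ true → x ∈ X × cov x X ≡ false
    isolated {x} {X} eq with x ∈? X | cov x X
    ... | yes x∈X | false = x∈X , refl

    -- The members of M that contain x are closed under adding its neighbours, at least q in number.
    -- Those that leave x uncovered contain none of these, so every neighbour contributes a factor
    -- 1/2.
    few : 2 ^ q * # Q ≤ # M
    few = begin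
      2 ^ q * # Q                  ≤⟨ *-monoˡ-≤ (# Q) (^-monoʳ-≤ 2 (proj₂ (deg x (here refl)))) ⟩
      2 ^ length (nbrs x) * # Q    ≤⟨ #-avoiding-list (nbrs x) (proj₁ (deg x (here refl))) P Q clP avoid ⟩
      # P                          ≤⟨ count-mono P M (allSubsets n) (λ X → proj₁ ∘ ∧⁻) ⟩
      # M                          ∎
      where
      clP : ∀ X z → z ∈ₗ nbrs x → P X ≡ true → P (X ∪ ⁅ z ⁆) ≡ true
      clP X z z∈ PX with ∧⁻ PX
      ... | MX , x∈ with does⁻ (x ∈? X) x∈
      ...   | x∈X = ∧⁺ (cl X x z (here refl) x∈X z∈ MX) (dec-true (x ∈? _) (p⊆p∪q ⁅ z ⁆ x∈X))
      avoid : ∀ X → Q X ≡ true → P X ≡ true × (∀ z → z ∈ₗ nbrs x → z ∉ X)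
      avoid X QX with ∧⁻ QX
      ... | MX , iso with isolated iso
      ...   | x∈X , ¬cov = ∧⁺ MX (dec-true (x ∈? X) x∈X) , λ z z∈ z∈X →
        case trans (sym ¬cov) (proj₁ (edge x X z z∈ x∈X z∈X)) of λ ()

    step : r * # M ≤ 2 ^ q * # M′
    -- Adding `# M` to both sides turns r into r + 1 = 2^q and avoids subtraction.
    step = +-cancelˡ-≤ (# M) _ _ (begin
      # M + r * # M                  ≡⟨ cong (_* # M) (m+[n∸m]≡n (m^n>0 2 q)) ⟩
      2 ^ q * # M                    ≡⟨ cong (2 ^ q *_) (count-split M (fine x) (allSubsets n)) ⟩
      2 ^ q * (# M′ + # Q)           ≡⟨ *-distribˡ-+ (2 ^ q) (# M′) (# Q) ⟩
      2 ^ q * # M′ + 2 ^ q * # Q     ≤⟨ +-monoʳ-≤ (2 ^ q * # M′) few ⟩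
      2 ^ q * # M′ + # M             ≡⟨ +-comm (2 ^ q * # M′) (# M) ⟩
      # M + 2 ^ q * # M′             ∎)

    cl′ : ∀ X y z → y ∈ₗ xs → y ∈ X → z ∈ₗ nbrs y → M′ X ≡ true → M′ (X ∪ ⁅ z ⁆) ≡ true
    cl′ X y z y∈ y∈X z∈ M′X with ∧⁻ M′X
    ... | MX , fx = ∧⁺ (cl X y z (there y∈) y∈X z∈ MX) fx′
      where
      Y = X ∪ ⁅ z ⁆
      fx′ : fine x Y ≡ true
      -- The added z may be x itself; then the edge to y, which is present, covers it.
      fx′ = fine⁺ λ x∈Y → case x∈p∪q⁻ X ⁅ z ⁆ x∈Y of λ where
        (inj₁ x∈X) → mono x X z (fine⁻ fx x∈X)
        (inj₂ x∈z) → subst (λ w → cov w Y ≡ true) (sym (x∈⁅y⁆⇒x≡y z x∈z))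
          (proj₂ (edge y Y z z∈ (p⊆p∪q ⁅ z ⁆ y∈X) (q⊆p∪q X ⁅ z ⁆ (x∈⁅x⁆ z))))

-- Unions, and sets of at most two elements.

all-false : (p : A → Bool) (xs : List A) → all p xs ≡ false → ∃[ x ] x ∈ₗ xs × p x ≡ false
all-false p (x ∷ xs) eq with p x in px
... | false = x , here refl , px
... | true with all-false p xs eq
...   | y , y∈ , py = y , there y∈ , py

all⁻ : (p : A → Bool) {xs : List A} {x : A} → all p xs ≡ true → x ∈ₗ xs → p x ≡ true
all⁻ p eq (here refl) = proj₁ (∧⁻ eq)
all⁻ p eq (there x∈) = all⁻ p (proj₂ (∧⁻ eq)) x∈

∈-sublists⁻ : (xs : List A) {ys : List A} {y : A} → ys ∈ₗ sublists xs → y ∈ₗ ys → y ∈ₗ xs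
∈-sublists⁻ [] (here refl) ()
∈-sublists⁻ (x ∷ xs) ys∈ y∈ with ∈-++⁻ (sublists xs) ys∈
... | inj₁ ys∈′ = there (∈-sublists⁻ xs ys∈′ y∈)
... | inj₂ ys∈′ with ∈-map⁻ (x ∷_) ys∈′
...   | zs , zs∈ , refl with y∈
...     | here refl = here refl
...     | there y∈zs = there (∈-sublists⁻ xs zs∈ y∈zs)

module _ {n : ℕ} where

  ∈-⋃⁺ : ∀ {S : List (Subset n)} {V x} → V ∈ₗ S → x ∈ V → x ∈ ⋃ S
  ∈-⋃⁺ (here refl) x∈ = p⊆p∪q _ x∈
  ∈-⋃⁺ (there V∈) x∈ = q⊆p∪q _ _ (∈-⋃⁺ V∈ x∈)

  ∈-⋃⁻ : ∀ (S : List (Subset n)) {x} → x ∈ ⋃ S → ∃[ V ] V ∈ₗ S × x ∈ V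
  ∈-⋃⁻ [] x∈ = contradiction x∈ ∉⊥
  ∈-⋃⁻ (V ∷ S) x∈ with x∈p∪q⁻ V (⋃ S) x∈
  ... | inj₁ x∈V = V , here refl , x∈V
  ... | inj₂ x∈S with ∈-⋃⁻ S x∈S
  ...   | W , W∈ , x∈W = W , there W∈ , x∈W

  ∈-─⁻ : ∀ (X Z : Subset n) {x} → x ∈ X ─ Z → x ∈ X × x ∉ Z
  ∈-─⁻ X Z {x} x∈ = p─q⊆p X Z x∈ , out X Z x∈
    where
    open import Data.Vec using (_[_]=_)
    out : ∀ {n} (X Z : Subset n) {x} → x ∈ X ─ Z → x ∉ Z
    out (_ ∷ _) (true ∷ _) () _[_]=_.here
    out (_ ∷ X) (_ ∷ Z) (_[_]=_.there x∈) (_[_]=_.there x∈Z) = out X Z x∈ x∈Z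

  ∈-pair⁻ : ∀ {v x y : Fin n} → v ∈ ⁅ x ⁆ ∪ ⁅ y ⁆ → v ≡ x ⊎ v ≡ y
  ∈-pair⁻ {v} {x} {y} v∈ with x∈p∪q⁻ ⁅ x ⁆ ⁅ y ⁆ v∈
  ... | inj₁ v∈x = inj₁ (x∈⁅y⁆⇒x≡y x v∈x)
  ... | inj₂ v∈y = inj₂ (x∈⁅y⁆⇒x≡y y v∈y)

  ∈-pairˡ : ∀ (x y : Fin n) → x ∈ ⁅ x ⁆ ∪ ⁅ y ⁆
  ∈-pairˡ x y = p⊆p∪q ⁅ y ⁆ (x∈⁅x⁆ x)

  ∈-pairʳ : ∀ (x y : Fin n) → y ∈ ⁅ x ⁆ ∪ ⁅ y ⁆
  ∈-pairʳ x y = q⊆p∪q ⁅ x ⁆ ⁅ y ⁆ (x∈⁅x⁆ y)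

  pair-⊆ : ∀ {x y : Fin n} {X} → x ∈ X → y ∈ X → ⁅ x ⁆ ∪ ⁅ y ⁆ ⊆ X
  pair-⊆ x∈ y∈ v∈ with ∈-pair⁻ v∈
  ... | inj₁ refl = x∈
  ... | inj₂ refl = y∈

  ∣X∣≤0⇒∉ : ∀ {X : Subset n} → ∣ X ∣ ≤ 0 → ∀ v → v ∉ X
  ∣X∣≤0⇒∉ {X} le v v∈ = case ≤-trans (x∈p⇒∣p-x∣<∣p∣ v∈) le of λ ()

  -- Choosing w = v for a singleton lets loops and edges share one form; otherwise removing v and a
  -- further element w exhausts e.
  small-pair : ∀ {v : Fin n} {e} → v ∈ e → ∣ e ∣ ≤ 2 → ∃[ w ] w ∈ e × e ≡ ⁅ v ⁆ ∪ ⁅ w ⁆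
  small-pair {v} {e} v∈e le with nonempty? (e ─ ⁅ v ⁆)
  ... | no emp = v , v∈e , ⊆-antisym sub (pair-⊆ v∈e v∈e)
    where
    sub : e ⊆ ⁅ v ⁆ ∪ ⁅ v ⁆
    sub {u} u∈ with u ∈? ⁅ v ⁆
    ... | yes u∈v = p⊆p∪q ⁅ v ⁆ u∈v
    ... | no u∉v = contradiction (u , x∈p∧x∉q⇒x∈p─q u∈ u∉v) emp
  ... | yes (w , w∈) = w , p─q⊆p e ⁅ v ⁆ w∈ , ⊆-antisym sub (pair-⊆ v∈e (p─q⊆p e ⁅ v ⁆ w∈))
    where
    none : ∣ (e ─ ⁅ v ⁆) ─ ⁅ w ⁆ ∣ ≤ 0
    none = ≤-pred (≤-trans (x∈p⇒∣p-x∣<∣p∣ w∈) (≤-pred (≤-trans (x∈p⇒∣p-x∣<∣p∣ v∈e) le)))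
    sub : e ⊆ ⁅ v ⁆ ∪ ⁅ w ⁆
    sub {u} u∈ with u ∈? ⁅ v ⁆ | u ∈? ⁅ w ⁆
    ... | yes u∈v | _ = p⊆p∪q ⁅ w ⁆ u∈v
    ... | no _ | yes u∈w = q⊆p∪q ⁅ v ⁆ ⁅ w ⁆ u∈w
    ... | no u∉v | no u∉w =
      contradiction (x∈p∧x∉q⇒x∈p─q (x∈p∧x∉q⇒x∈p─q u∈ u∉v) u∉w) (∣X∣≤0⇒∉ none u)

  -- Splits the test into membership bits, so that degrees can be compared by a finite case check.
  touches-pair : ∀ (W : Subset n) a b → nonemptyᵇ (W ∩ (⁅ a ⁆ ∪ ⁅ b ⁆)) ≡ does (a ∈? W) ∨ does (b ∈? W)
  touches-pair W a b with a ∈? W | b ∈? W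
  ... | yes a∈ | _ = dec-true (nonempty? _) (a , x∈p∩q⁺ (a∈ , ∈-pairˡ a b))
  ... | no _ | yes b∈ = dec-true (nonempty? _) (b , x∈p∩q⁺ (b∈ , ∈-pairʳ a b))
  ... | no a∉ | no b∉ = dec-false (nonempty? _) λ (v , v∈) →
    let v∈W , v∈ab = x∈p∩q⁻ W _ v∈ in
    case ∈-pair⁻ v∈ab of λ where
      (inj₁ refl) → a∉ v∈W
      (inj₂ refl) → b∉ v∈W

  _==?_ : (X Y : Subset n) → Dec (X ≡ Y)
  _==?_ = Vec.≡-dec Bo._≟_

  #-== : ∀ (V : Subset n) → # (_== V) ≡ 1
  #-== V = ≤-antisym
    (unique-⊆-length {ys = [ V ]} (filterB-unique _ (allSubsets-unique n))
      (λ X∈ → here (does⁻ (_ ==? V) (proj₂ (filterB⁻ (_== V) (allSubsets n) X∈)))))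
    (unique-⊆-length {xs = [ V ]} ([] ∷ [])
      (λ { (here refl) → ∈-filter-all (_== V) (dec-true (V ==? V) refl) }))

  #-both-fail : (P f g : Subset n → Bool) → # P ≤ # (λ X → P X ∧ f X) + # (λ X → P X ∧ g X) →
    # (λ X → P X ∧ (not (f X) ∧ not (g X))) ≤ # (λ X → P X ∧ (f X ∧ g X))
  #-both-fail P f g le = begin
    # (λ X → P X ∧ (not (f X) ∧ not (g X)))  ≤⟨ count-mono _ _ all₀ (λ X → trans (∧-assoc (P X) _ _)) ⟩
    # (λ X → (P X ∧ not (f X)) ∧ not (g X))  ≤⟨ +-cancelˡ-≤ (# (λ X → (P X ∧ not (f X)) ∧ g X)) _ _ main ⟩
    # (λ X → (P X ∧ g X) ∧ f X)              ≤⟨ count-mono _ _ all₀ (λ X → shuffle₁ (P X) (f X) (g X)) ⟩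
    # (λ X → P X ∧ (f X ∧ g X))              ∎
    where
    open ≤-Reasoning
    all₀ = allSubsets n
    shuffle₁ : ∀ p f g → (p ∧ g) ∧ f ≡ true → p ∧ (f ∧ g) ≡ true
    shuffle₁ true true true _ = refl
    shuffle₂ : ∀ p f g → (p ∧ g) ∧ not f ≡ true → (p ∧ not f) ∧ g ≡ true
    shuffle₂ true false true _ = refl
    -- Inclusion-exclusion without subtraction: the sets failing f are at most as many as those
    -- satisfying g; removing from both counts the sets with g and not f leaves the claim.
    notf : # (λ X → P X ∧ not (f X)) ≤ # (λ X → P X ∧ g X)
    notf = +-cancelˡ-≤ (# (λ X → P X ∧ f X)) _ _
      (≤-trans (≤-reflexive (sym (count-split P f all₀))) le)
    main : # (λ X → (P X ∧ not (f X)) ∧ g X) + # (λ X → (P X ∧ not (f X)) ∧ not (g X))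
         ≤ # (λ X → (P X ∧ not (f X)) ∧ g X) + # (λ X → (P X ∧ g X) ∧ f X)
    main = begin
      # (λ X → (P X ∧ not (f X)) ∧ g X) + # (λ X → (P X ∧ not (f X)) ∧ not (g X))
        ≡⟨ count-split (λ X → P X ∧ not (f X)) g all₀ ⟨
      # (λ X → P X ∧ not (f X))
        ≤⟨ notf ⟩
      # (λ X → P X ∧ g X)
        ≡⟨ count-split (λ X → P X ∧ g X) f all₀ ⟩
      # (λ X → (P X ∧ g X) ∧ f X) + # (λ X → (P X ∧ g X) ∧ not (f X))
        ≡⟨ +-comm (# (λ X → (P X ∧ g X) ∧ f X)) _ ⟩
      # (λ X → (P X ∧ g X) ∧ not (f X)) + # (λ X → (P X ∧ g X) ∧ f X)
        ≤⟨ +-monoˡ-≤ _ (count-mono _ _ all₀ (λ X → shuffle₂ (P X) (f X) (g X))) ⟩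
      # (λ X → (P X ∧ not (f X)) ∧ g X) + # (λ X → (P X ∧ g X) ∧ f X) ∎

-- Families generated by edges and loops

module _ {n : ℕ} (F : Fam n) where

  ∈-π⁺ : ∀ {X V x} → F V ≡ true → V ⊆ X → x ∈ V → x ∈ π F X
  ∈-π⁺ {X} FV V⊆X x∈ = ∈-⋃⁺ (filterB⁺ (_⊆ᵇ X) (∈-filter-all F FV) (dec-true (_ ⊆? X) V⊆X)) x∈

  ∈-π⁻ : ∀ {X x} → x ∈ π F X → ∃[ V ] F V ≡ true × V ⊆ X × x ∈ V
  ∈-π⁻ {X} x∈ with ∈-⋃⁻ (filterB (_⊆ᵇ X) (members F)) x∈
  ... | V , V∈ , x∈V with filterB⁻ (_⊆ᵇ X) (members F) V∈
  ...   | V∈F , V⊆X = V , proj₂ (filterB⁻ F (allSubsets n) V∈F) , does⁻ (V ⊆? X) V⊆X , x∈V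

  π-mono : ∀ {X Y} → X ⊆ Y → π F X ⊆ π F Y
  π-mono X⊆Y x∈ with ∈-π⁻ x∈
  ... | V , FV , V⊆X , x∈V = ∈-π⁺ FV (X⊆Y ∘ V⊆X) x∈V

  -- adj v v says that the singleton of v lies in F.
  adj : Fin n → Fin n → Bool
  adj v w = F (⁅ v ⁆ ∪ ⁅ w ⁆)

  adj-sym : ∀ {v w} → adj v w ≡ true → adj w v ≡ true
  adj-sym {v} {w} = subst (λ e → F e ≡ true) (∪-comm ⁅ v ⁆ ⁅ w ⁆)

  -- With w = v allowed, this says locally that every member of `F` is a union of pairs and
  -- singletons lying in `F`.
  GeneratedByEdges : Set
  GeneratedByEdges = ∀ V v → F V ≡ true → v ∈ V → ∃[ w ] w ∈ V × adj v w ≡ true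

  J⇒F : ∀ {V} → J F V ≡ true → F V ≡ true
  J⇒F {V} JV = proj₁ (∧⁻ {F V} JV)

  SmallGenerators : Set
  SmallGenerators = ∀ V → J F V ≡ true → ∣ V ∣ ≡ 1 ⊎ ∣ V ∣ ≡ 2

  J≤2 : SmallGenerators → ∀ {V} → J F V ≡ true → ∣ V ∣ ≤ 2
  J≤2 small JV = [ (λ e → ≤-trans (≤-reflexive e) (n≤1+n 1)) , ≤-reflexive ]′ (small _ JV)

  -- Every member of N(W) is a union of generators; one that contains v has at most two elements and
  -- supplies w.
  N-edges : SmallGenerators → ∀ W → (∀ X → F X ≡ N F W X) → GeneratedByEdges
  N-edges small W F≡N V v FV v∈V with any⁻ (λ S → V == ⋃ S) _ (trans (sym (F≡N V)) FV)
  ... | S , S∈ , V==S with does⁻ (V ==? ⋃ S) V==S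
  ...   | refl with ∈-⋃⁻ S v∈V
  ...     | e , e∈S , v∈e with proj₁ (∧⁻ {J F e} (proj₂ (filterB⁻ (λ V → J F V ∧ nonemptyᵇ (V ∩ W)) (allSubsets n) (∈-sublists⁻ _ S∈ e∈S))))
  ...       | Je with small-pair v∈e (J≤2 small {e} Je)
  ...         | w , w∈e , refl = w , ∈-⋃⁺ e∈S w∈e , J⇒F {e} Je

  covered⁺ : ∀ {X v w} → v ∈ X → w ∈ X → adj v w ≡ true → v ∈ π F X
  covered⁺ {v = v} {w} v∈ w∈ vw = ∈-π⁺ vw (pair-⊆ v∈ w∈) (∈-pairˡ v w)

  covered⁻ : GeneratedByEdges → ∀ {X v} → v ∈ π F X → v ∈ X × ∃[ w ] w ∈ X × adj v w ≡ true
  covered⁻ gen v∈ with ∈-π⁻ v∈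
  ... | V , FV , V⊆X , v∈V with gen V _ FV v∈V
  ...   | w , w∈V , vw = V⊆X v∈V , w , V⊆X w∈V , vw

  cov : Fin n → Subset n → Bool
  cov x X = does (x ∈? π F X)

  -- The first vertex is contained, the second missed: `a b` gives the edges counted by p, and `b a`
  -- those counted by q.
  edges-missing : Fin n → Fin n → Subset n → Bool
  edges-missing x y W = J′ F W ∧ (not (does (y ∈? W)) ∧ does (x ∈? W))

  module _ (U : Subset n) where

    isNbr : Fin n → Fin n → Bool
    isNbr x z = not (does (z ∈? U)) ∧ adj x z

    nbrs : Fin n → List (Fin n)
    nbrs x = filterB (isNbr x) (allFin n)

    -- The set A for `a b`, and B for `b a`. Looped vertices are left out because they are covered
    -- whenever present, neighbours of b because b can cover them after a is dropped from U.
    isPrivate : Fin n → Fin n → Fin n → Bool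
    isPrivate a b x = not (does (x ∈? U)) ∧ (adj a x ∧ (not (adj b x) ∧ not (adj x x)))

    private-nbrs : Fin n → Fin n → List (Fin n)
    private-nbrs a b = filterB (isPrivate a b) (allFin n)

    allFine : Fin n → Fin n → Subset n → Bool
    allFine a b X = all (λ x → fine cov nbrs x X) (private-nbrs a b)

    isPrivate⁻ : ∀ {a b x} → isPrivate a b x ≡ true →
      x ∉ U × adj a x ≡ true × adj b x ≡ false × adj x x ≡ false
    isPrivate⁻ {x = x} e with ∧⁻ e
    ... | x∉ , e₁ with ∧⁻ e₁
    ...   | ax , e₂ with ∧⁻ e₂
    ...     | bx , xx = does-no (x ∈? U) (not⁻ x∉) , ax , not⁻ bx , not⁻ xx

    ∈-private⁻ : ∀ {a b x} → x ∈ₗ private-nbrs a b →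
      x ∉ U × adj a x ≡ true × adj b x ≡ false × adj x x ≡ false
    ∈-private⁻ {a} {b} x∈ = isPrivate⁻ (proj₂ (filterB⁻ (isPrivate a b) (allFin n) x∈))

    ∈-nbrs⁻ : ∀ {x z} → z ∈ₗ nbrs x → z ∉ U × adj x z ≡ true
    ∈-nbrs⁻ {x} {z} z∈ with ∧⁻ (proj₂ (filterB⁻ (isNbr x) (allFin n) z∈))
    ... | z∉ , xz = does-no (z ∈? U) (not⁻ z∉) , xz

    -- The list may be shorter than p; the d missing factors are supplied by 2^q - 1 ≤ 2^q, which
    -- weakens the bound to the exponent p that `half-fine` needs.
    closed-fine : (a b : Fin n) (M : Subset n → Bool) (p q : ℕ) → length (private-nbrs a b) ≤ p →
      (∀ x → x ∈ₗ private-nbrs a b → q ≤ length (nbrs x)) →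
      (∀ X x z → x ∈ X → z ∉ U → adj x z ≡ true → M X ≡ true → M (X ∪ ⁅ z ⁆) ≡ true) →
      (2 ^ q ∸ 1) ^ p * # M ≤ (2 ^ q) ^ p * # (λ X → M X ∧ allFine a b X)
    closed-fine a b M p q l≤p deg cl = begin
      r ^ p * # M                    ≡⟨ cong (λ k → r ^ k * # M) p≡ ⟨
      r ^ (d + l) * # M              ≡⟨ cong (_* # M) (^-distribˡ-+-* r d l) ⟩
      r ^ d * r ^ l * # M            ≡⟨ *-assoc (r ^ d) (r ^ l) (# M) ⟩
      r ^ d * (r ^ l * # M)          ≤⟨ *-mono-≤ (^-monoˡ-≤ d (m∸n≤m (2 ^ q) 1)) chain ⟩
      t ^ d * (t ^ l * # N₀)         ≡⟨ *-assoc (t ^ d) (t ^ l) (# N₀) ⟨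
      t ^ d * t ^ l * # N₀           ≡⟨ cong (_* # N₀) (^-distribˡ-+-* t d l) ⟨
      t ^ (d + l) * # N₀             ≡⟨ cong (λ k → t ^ k * # N₀) p≡ ⟩
      t ^ p * # N₀                   ∎
      where
      open ≤-Reasoning
      l = length (private-nbrs a b)
      d = p ∸ l
      r = 2 ^ q ∸ 1
      t = 2 ^ q
      N₀ : Subset n → Bool
      N₀ X = M X ∧ allFine a b X
      p≡ : d + l ≡ p
      p≡ = m∸n+n≡m l≤p
      chain : r ^ l * # M ≤ t ^ l * # N₀
      chain = #-all-fine cov nbrs
        (λ x X z x∈ → dec-true (x ∈? _) (π-mono (p⊆p∪q ⁅ z ⁆) (does⁻ (x ∈? π F X) x∈)))
        (λ x X z z∈ x∈X z∈X → let xz = proj₂ (∈-nbrs⁻ z∈) in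
          dec-true (x ∈? _) (covered⁺ x∈X z∈X xz) , dec-true (z ∈? _) (covered⁺ z∈X x∈X (adj-sym xz)))
        q (private-nbrs a b)
        (λ x x∈ → filterB-unique _ (allFin⁺ n) , deg x x∈)
        M
        (λ X x z _ x∈X z∈ MX → let z∉U , xz = ∈-nbrs⁻ z∈ in cl X x z x∈X z∉U xz MX)

-- The degree hypothesis

-- Here j says that W is a two-element generator, and α, β, ξ, u, v stand for a ∈ W, b ∈ W, x ∈ W, W
-- = U, W = V, where V = {a, x}. Once V and U are put back among the edges that meet them, the left
-- side equals j times [α] + [ξ, not α] + [β, not α], and the right side is at least that.
deg-exchange : ∀ j α β ξ u v → (u ≡ true → α ≡ true) → (v ≡ true → α ≡ true × j ≡ true) →
  𝟙 (j ∧ (not v ∧ (α ∨ ξ))) + (𝟙 (j ∧ (not α ∧ β)) + 𝟙 v)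
  ≤ 𝟙 (j ∧ (not u ∧ (α ∨ β))) + (𝟙 (j ∧ (not α ∧ ξ)) + 𝟙 u)
deg-exchange j false β ξ true v hu hv = case hu refl of λ ()
deg-exchange j false β ξ false true hu hv = case proj₁ (hv refl) of λ ()
deg-exchange false false β ξ false false hu hv = z≤n
deg-exchange true false false false false false hu hv = z≤n
deg-exchange true false false true false false hu hv = ≤-refl
deg-exchange true false true false false false hu hv = ≤-refl
deg-exchange true false true true false false hu hv = ≤-refl
deg-exchange false true β ξ u true hu hv = case proj₂ (hv refl) of λ ()
deg-exchange false true β ξ u false hu hv = z≤n
deg-exchange true true β ξ true true hu hv = ≤-refl
deg-exchange true true β ξ true false hu hv = ≤-refl
deg-exchange true true β ξ false true hu hv = ≤-refl
deg-exchange true true β ξ false false hu hv = ≤-refl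

module _ {n : ℕ} (F : Fam n) (small : SmallGenerators F) (a b : Fin n) (U : Subset n)
         (U≡ : U ≡ ⁅ a ⁆ ∪ ⁅ b ⁆) (a≢b : a ≢ b) where

  private
    a∈U : a ∈ U
    a∈U = subst (a ∈_) (sym U≡) (∈-pairˡ a b)
    b∈U : b ∈ U
    b∈U = subst (b ∈_) (sym U≡) (∈-pairʳ a b)
    ∈U⁻ : ∀ {v} → v ∈ U → v ≡ a ⊎ v ≡ b
    ∈U⁻ {v} v∈ = ∈-pair⁻ (subst (v ∈_) U≡ v∈)

  -- If the pair were a union of smaller members, one of them would contain x and hence miss a, so
  -- it would be {x}; but x has no loop.
  private-edge-J′ : ∀ {x} → x ∉ U → adj F a x ≡ true → adj F x x ≡ false → J′ F (⁅ a ⁆ ∪ ⁅ x ⁆) ≡ true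
  private-edge-J′ {x} x∉U ax xx = ∧⁺ JV (cong (_≡ᵇ 2) ∣V∣≡2)
    where
    V = ⁅ a ⁆ ∪ ⁅ x ⁆
    proper : Subset n → Bool
    proper W = (W ⊆ᵇ V) ∧ not (W == V)
    x≢a : x ≢ a
    x≢a refl = x∉U a∈U
    not-⋃ : V ≢ ⋃ (filterB proper (members F))
    not-⋃ eq with ∈-⋃⁻ (filterB proper (members F)) (subst (x ∈_) eq (∈-pairʳ a x))
    ... | W , W∈ , x∈W with filterB⁻ proper (members F) W∈
    ...   | W∈F , pr with ∧⁻ pr
    ...     | sub , ne = case trans (sym xx) FW of λ ()
      where
      W⊆V : W ⊆ V
      W⊆V = does⁻ (W ⊆? V) sub
      a∉W : a ∉ W
      a∉W a∈W = does-no (W ==? V) (not⁻ ne) (⊆-antisym W⊆V (pair-⊆ a∈W x∈W))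
      W≡ : W ≡ ⁅ x ⁆ ∪ ⁅ x ⁆
      W≡ = ⊆-antisym
        (λ {v} v∈ → case ∈-pair⁻ (W⊆V v∈) of λ where
          (inj₁ refl) → contradiction v∈ a∉W
          (inj₂ refl) → ∈-pairˡ x x)
        (pair-⊆ x∈W x∈W)
      FW : adj F x x ≡ true
      FW = subst (λ e → F e ≡ true) W≡ (proj₂ (filterB⁻ F (allSubsets n) W∈F))
    JV : J F V ≡ true
    JV = ∧⁺ ax (∧⁺ (dec-true (nonempty? V) (a , ∈-pairˡ a x)) (cong not (dec-false (V ==? _) not-⋃)))
    ∣V∣≡2 : ∣ V ∣ ≡ 2
    ∣V∣≡2 = ≤-antisym (J≤2 F small {V} JV) (≤-trans (s≤s (≤-reflexive (sym (∣⁅x⁆∣≡1 a))))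
      (p⊂q⇒∣p∣<∣q∣ (p⊆p∪q ⁅ x ⁆ , x , ∈-pairʳ a x , x≢a ∘ x∈⁅y⁆⇒x≡y a)))

  -- A vertex x outside U is recovered from the edge {a, x}, which misses b; the relation records x
  -- ≢ a for this purpose.
  length-private : length (private-nbrs F U a b) ≤ # (edges-missing F a b)
  length-private = count-pigeonhole (λ x W → W ≡ ⁅ a ⁆ ∪ ⁅ x ⁆ × x ≢ a) _ _ (allFin n) (allSubsets n) (allFin⁺ n)
    (λ x priv → let x∉U , ax , _ , xx = isPrivate⁻ F U priv in
      ⁅ a ⁆ ∪ ⁅ x ⁆ , allSubsets-complete _ ,
      ∧⁺ (private-edge-J′ x∉U ax xx)
        (∧⁺ (cong not (dec-false (b ∈? _) λ b∈ → case ∈-pair⁻ b∈ of λ where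
          (inj₁ b≡a) → a≢b (sym b≡a)
          (inj₂ refl) → x∉U b∈U)) (dec-true (a ∈? _) (∈-pairˡ a x))) ,
      refl , λ { refl → x∉U a∈U })
    (λ { {x} {x′} (refl , x≢a) (eq , _) → case ∈-pair⁻ (subst (x ∈_) eq (∈-pairʳ a x)) of λ where
      (inj₁ x≡a) → contradiction x≡a x≢a
      (inj₂ x≡x′) → x≡x′ })

  -- Counted with itself, {a, x} meets the edges through a and those through x missing a; U meets
  -- those through a and those through b missing a. The degree hypothesis thus compares the second
  -- kinds, and edges through x missing a lead outside U.
  edges-missing≤nbrs : (∀ {V} → J′ F V ≡ true → Nonempty (V ∩ U) → deg (J′ F) U ≤ deg (J′ F) V) →
    GeneratedByEdges F → ∀ {x} → x ∈ₗ private-nbrs F U a b → # (edges-missing F b a) ≤ length (nbrs F U x)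
  edges-missing≤nbrs hyp gen {x} x∈ with ∈-private⁻ F U x∈
  ... | x∉U , ax , bx , xx = ≤-trans exchanged to-vertices
    where
    open ≤-Reasoning
    S = allSubsets n
    V = ⁅ a ⁆ ∪ ⁅ x ⁆
    JV : J′ F V ≡ true
    JV = private-edge-J′ x∉U ax xx
    dV dU : Subset n → Bool
    dV W = J′ F W ∧ (not (W == V) ∧ nonemptyᵇ (W ∩ V))
    dU W = J′ F W ∧ (not (W == U) ∧ nonemptyᵇ (W ∩ U))

    deg≡ : ∀ X → deg (J′ F) X ≡ # (λ W → J′ F W ∧ (not (W == X) ∧ nonemptyᵇ (W ∩ X)))
    deg≡ X = cong length (filterB-filterB (J′ F) (λ W → not (W == X) ∧ nonemptyᵇ (W ∩ X)) S)

    le : # dU ≤ # dV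
    le = begin
      # dU          ≡⟨ deg≡ U ⟨
      deg (J′ F) U  ≤⟨ hyp JV (a , x∈p∩q⁺ (∈-pairˡ a x , a∈U)) ⟩
      deg (J′ F) V  ≡⟨ deg≡ V ⟩
      # dV          ∎

    pointwise : ∀ W → 𝟙 (dV W) + (𝟙 (edges-missing F b a W) + 𝟙 (W == V))
                    ≤ 𝟙 (dU W) + (𝟙 (edges-missing F x a W) + 𝟙 (W == U))
    pointwise W rewrite touches-pair W a x | trans (cong (λ X → nonemptyᵇ (W ∩ X)) U≡) (touches-pair W a b) =
      deg-exchange (J′ F W) (does (a ∈? W)) (does (b ∈? W)) (does (x ∈? W)) (W == U) (W == V)
        (λ e → dec-true (a ∈? W) (subst (a ∈_) (sym (does⁻ (W ==? U) e)) a∈U))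
        (λ e → let W≡V = does⁻ (W ==? V) e in
          dec-true (a ∈? W) (subst (a ∈_) (sym W≡V) (∈-pairˡ a x)) ,
          subst (λ X → J′ F X ≡ true) (sym W≡V) JV)

    #-sum₃ : ∀ p q r → # p + (# q + # r) ≡ sum (map (λ W → 𝟙 (p W) + (𝟙 (q W) + 𝟙 (r W))) S)
    #-sum₃ p q r rewrite count≡sum p S | count≡sum q S | count≡sum r S
      | sum-map-+ (𝟙 ∘ q) (𝟙 ∘ r) S = sum-map-+ (𝟙 ∘ p) _ S

    -- The two summands 1 are V and U, which their own degrees omit.
    summed : # dV + (# (edges-missing F b a) + 1) ≤ # dU + (# (edges-missing F x a) + 1)
    summed = begin
      # dV + (# (edges-missing F b a) + 1)         ≡⟨ cong (λ k → # dV + (# (edges-missing F b a) + k)) (#-== V) ⟨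
      # dV + (# (edges-missing F b a) + # (_== V)) ≡⟨ #-sum₃ dV (edges-missing F b a) (_== V) ⟩
      _                                          ≤⟨ sum-map-mono _ _ S (λ W _ → pointwise W) ⟩
      _                                          ≡⟨ #-sum₃ dU (edges-missing F x a) (_== U) ⟨
      # dU + (# (edges-missing F x a) + # (_== U)) ≡⟨ cong (λ k → # dU + (# (edges-missing F x a) + k)) (#-== U) ⟩
      # dU + (# (edges-missing F x a) + 1)         ∎

    exchanged : # (edges-missing F b a) ≤ # (edges-missing F x a)
    exchanged = +-cancelʳ-≤ 1 _ _ (+-cancelˡ-≤ (# dV) _ _ (≤-trans summed (+-monoˡ-≤ _ le)))

    to-vertices : # (edges-missing F x a) ≤ length (nbrs F U x)
    to-vertices = count-pigeonhole (λ W z → W ≡ ⁅ x ⁆ ∪ ⁅ z ⁆) (edges-missing F x a) (isNbr F U x)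
      S (allFin n) (allSubsets-unique n) target (λ { refl refl → refl })
      where
      target : ∀ W → edges-missing F x a W ≡ true → ∃[ z ] z ∈ₗ allFin n × isNbr F U x z ≡ true × W ≡ ⁅ x ⁆ ∪ ⁅ z ⁆
      target W e with ∧⁻ {J′ F W} e
      ... | J′W , e₁ with ∧⁻ e₁
      ...   | a∉ , x∈W with ∧⁻ {J F W} J′W
      ...     | JW , _ with small-pair (does⁻ (x ∈? W) x∈W) (J≤2 F small {W} JW)
      ...       | z , z∈W , refl = z , ∈-allFin z , ∧⁺ (cong not (dec-false (z ∈? U) z∉U)) xz , refl
        where
        xz : adj F x z ≡ true
        xz = J⇒F F {W} JW
        -- z = a is excluded since W misses a, and z = b since x is no neighbour of b.
        z∉U : z ∉ U
        z∉U z∈ with ∈U⁻ z∈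
        ... | inj₁ refl = does-no (a ∈? W) (not⁻ a∉) z∈W
        ... | inj₂ refl = case trans (sym bx) (adj-sym F xz) of λ ()

-- Lower bounds for |E(X)|

module _ {n : ℕ} (F : Fam n) (gen : GeneratedByEdges F) (a b : Fin n) (U : Subset n)
         (U≡ : U ≡ ⁅ a ⁆ ∪ ⁅ b ⁆) where

  private
    b∈U : b ∈ U
    b∈U = subst (b ∈_) (sym U≡) (∈-pairʳ a b)
    ∈U⁻ : ∀ {v} → v ∈ U → v ≡ a ⊎ v ≡ b
    ∈U⁻ {v} v∈ = ∈-pair⁻ (subst (v ∈_) U≡ v∈)

  -- A vertex that fails is a neighbour of a present in X. Hence failure of both lists forces
  -- `bothCovered`.
  not-allFine : ∀ {X} → allFine F U a b X ≡ false → a ∈ π F (X ∪ ⁅ a ⁆)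
  not-allFine {X} eq with all-false _ (private-nbrs F U a b) eq
  ... | x , x∈ , unfine with x ∈? X
  ...   | yes x∈X = covered⁺ F (q⊆p∪q X ⁅ a ⁆ (x∈⁅x⁆ a)) (p⊆p∪q ⁅ a ⁆ x∈X) (proj₁ (proj₂ (∈-private⁻ F U x∈)))

  module _ {X : Subset n} (X∩U : ∀ {v} → v ∈ X → v ∉ U) where

    -- π(X ∪ Y) lies in X ∪ Y and X misses U, so one half of π(X ∪ Y) ∩ U = Y is automatic.
    E⁺ : ∀ {Y} → Y ⊆ U → Y ⊆ π F (X ∪ Y) →
      (∀ {v} → v ∈ π F (X ∪ U) → v ∉ U → v ∈ π F (X ∪ Y)) → Eᵇ F U X Y ≡ true
    E⁺ {Y} Y⊆U Y⊆π rest = ∧⁺ (dec-true (Y ⊆? U) Y⊆U) (∧⁺ (dec-true (_ ==? Y) eq) (dec-true (_ ⊆? _) sub))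
      where
      eq : π F (X ∪ Y) ∩ U ≡ Y
      eq = ⊆-antisym
        (λ v∈ → let v∈π , v∈U = x∈p∩q⁻ (π F (X ∪ Y)) U v∈ in
          case x∈p∪q⁻ X Y (proj₁ (covered⁻ F gen v∈π)) of λ where
            (inj₁ v∈X) → contradiction v∈U (X∩U v∈X)
            (inj₂ v∈Y) → v∈Y)
        (λ v∈Y → x∈p∩q⁺ (Y⊆π v∈Y , Y⊆U v∈Y))
      sub : π F (X ∪ U) ─ U ⊆ π F (X ∪ Y)
      sub v∈ = let v∈π , v∉U = ∈-─⁻ (π F (X ∪ U)) U v∈ in rest v∈π v∉U

    U∈E : F U ≡ true → Eᵇ F U X U ≡ true
    U∈E FU = E⁺ id (∈-π⁺ F FU (q⊆p∪q X U)) (λ v∈ _ → v∈)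

    -- Only vertices covered through a are at risk when a is dropped; such a v is a neighbour of b,
    -- has a loop, or is private and hence fine in X.
    covered-without-a : allFine F U a b X ≡ true → ∀ {v} → v ∈ π F (X ∪ U) → v ∉ U →
      v ∈ π F X ⊎ (v ∈ X × adj F b v ≡ true)
    covered-without-a fineX {v} v∈ v∉U with covered⁻ F gen v∈
    ... | v∈XU , w , w∈XU , vw with [ id , (λ v∈U → contradiction v∈U v∉U) ]′ (x∈p∪q⁻ X U v∈XU)
    ...   | v∈X with x∈p∪q⁻ X U w∈XU
    ...     | inj₁ w∈X = inj₁ (covered⁺ F v∈X w∈X vw)
    ...     | inj₂ w∈U with ∈U⁻ w∈U
    ...       | inj₂ refl = inj₂ (v∈X , adj-sym F vw)
    ...       | inj₁ refl with adj F b v in bv | adj F v v in vv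
    ...         | true | _ = inj₂ (v∈X , refl)
    ...         | false | true = inj₁ (covered⁺ F v∈X v∈X vv)
    ...         | false | false = inj₁ (does⁻ (v ∈? π F X)
      (fine⁻ (cov F) (nbrs F U) (all⁻ _ fineX (filterB⁺ (isPrivate F U a b) (∈-allFin v) priv)) v∈X))
      where
      priv : isPrivate F U a b v ≡ true
      priv = ∧⁺ (cong not (dec-false (v ∈? U) v∉U)) (∧⁺ (adj-sym F vw) (∧⁺ (cong not bv) (cong not vv)))

    b∈E : allFine F U a b X ≡ true → b ∈ π F (X ∪ ⁅ b ⁆) → Eᵇ F U X ⁅ b ⁆ ≡ true
    b∈E fineX b∈π = E⁺
      (λ v∈ → subst (_∈ U) (sym (x∈⁅y⁆⇒x≡y b v∈)) b∈U)
      (λ v∈ → subst (_∈ π F (X ∪ ⁅ b ⁆)) (sym (x∈⁅y⁆⇒x≡y b v∈)) b∈π)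
      (λ v∈ v∉U → case covered-without-a fineX v∈ v∉U of λ where
        (inj₁ v∈π) → π-mono F (p⊆p∪q ⁅ b ⁆) v∈π
        (inj₂ (v∈X , bv)) → covered⁺ F (p⊆p∪q ⁅ b ⁆ v∈X) (q⊆p∪q X ⁅ b ⁆ (x∈⁅x⁆ b)) (adj-sym F bv))

    -- No edge joins b to X here, so all that X ∪ U covers outside U is already covered within X.
    ⊥∈E : allFine F U a b X ≡ true → b ∉ π F (X ∪ ⁅ b ⁆) → Eᵇ F U X ⊥ ≡ true
    ⊥∈E fineX b∉π = E⁺
      (λ v∈ → contradiction v∈ ∉⊥)
      (λ v∈ → contradiction v∈ ∉⊥)
      (λ v∈ v∉U → case covered-without-a fineX v∈ v∉U of λ where
        (inj₁ v∈π) → π-mono F (p⊆p∪q ⊥) v∈π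
        (inj₂ (v∈X , bv)) →
          contradiction (covered⁺ F (q⊆p∪q X ⁅ b ⁆ (x∈⁅x⁆ b)) (p⊆p∪q ⁅ b ⁆ v∈X) bv) b∉π)

    -- Besides U, the family E(X) contains {b} or ∅, according to whether X ∪ {b} covers b.
    2≤Ecard : F U ≡ true → a ≢ b → allFine F U a b X ≡ true → 2 ≤ Ecard F U X
    2≤Ecard FU a≢b fineX with b ∈? π F (X ∪ ⁅ b ⁆)
    ... | yes b∈π = unique-⊆-length {xs = U ∷ ⁅ b ⁆ ∷ []}
      (((λ eq → a≢b (x∈⁅y⁆⇒x≡y b (subst (a ∈_) eq a∈U))) ∷ []) ∷ [] ∷ [])
      (λ { (here refl) → ∈-filter-all (Eᵇ F U X) (U∈E FU)
         ; (there (here refl)) → ∈-filter-all (Eᵇ F U X) (b∈E fineX b∈π) })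
      where
      a∈U : a ∈ U
      a∈U = subst (a ∈_) (sym U≡) (∈-pairˡ a b)
    ... | no b∉π = unique-⊆-length {xs = U ∷ ⊥ ∷ []}
      (((λ eq → ∉⊥ (subst (b ∈_) eq b∈U)) ∷ []) ∷ [] ∷ [])
      (λ { (here refl) → ∈-filter-all (Eᵇ F U X) (U∈E FU)
         ; (there (here refl)) → ∈-filter-all (Eᵇ F U X) (⊥∈E fineX b∉π) })

module _ {n : ℕ} (F : Fam n) (a b : Fin n) where

  -- Together with membership in the trace this defines M.
  bothCovered : Subset n → Bool
  bothCovered X = does (a ∈? π F (X ∪ ⁅ a ⁆)) ∧ does (b ∈? π F (X ∪ ⁅ b ⁆))

  bothCovered-mono : ∀ {X Y} → X ⊆ Y → bothCovered X ≡ true → bothCovered Y ≡ true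
  bothCovered-mono {X} {Y} X⊆Y e with ∧⁻ e
  ... | a∈ , b∈ = ∧⁺ (dec-true (a ∈? _) (π-mono F (step a) (does⁻ (a ∈? _) a∈)))
                     (dec-true (b ∈? _) (π-mono F (step b) (does⁻ (b ∈? _) b∈)))
    where
    step : ∀ c → X ∪ ⁅ c ⁆ ⊆ Y ∪ ⁅ c ⁆
    step c v∈ with x∈p∪q⁻ X ⁅ c ⁆ v∈
    ... | inj₁ v∈X = p⊆p∪q ⁅ c ⁆ (X⊆Y v∈X)
    ... | inj₂ v∈c = q⊆p∪q Y ⁅ c ⁆ v∈c

  module _ (U : Subset n) where

    -- `good` marks the sets with an element of E(X) to spare over two, `bad` those for which only U
    -- is guaranteed.
    good bad : Subset n → Bool
    good X = bothCovered X ∧ (allFine F U a b X ∧ allFine F U b a X)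
    bad X = bothCovered X ∧ (not (allFine F U a b X) ∧ not (allFine F U b a X))

module _ {n : ℕ} (F : Fam n) (gen : GeneratedByEdges F) (a b : Fin n) (U : Subset n)
         (U≡ : U ≡ ⁅ a ⁆ ∪ ⁅ b ⁆) (a≢b : a ≢ b) (FU : F U ≡ true) where

  private
    U≡′ : U ≡ ⁅ b ⁆ ∪ ⁅ a ⁆
    U≡′ = trans U≡ (∪-comm ⁅ a ⁆ ⁅ b ⁆)
    a∈U : a ∈ U
    a∈U = subst (a ∈_) (sym U≡) (∈-pairˡ a b)
    b∈U : b ∈ U
    b∈U = subst (b ∈_) (sym U≡) (∈-pairʳ a b)

  -- Either vertex of U may be dropped, which gives {a} and {b} besides U; `b∈E` serves for both
  -- after exchanging a and b.
  3≤Ecard : ∀ {X} → (∀ {v} → v ∈ X → v ∉ U) → good F a b U X ≡ true → 3 ≤ Ecard F U X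
  3≤Ecard {X} X∩U e with ∧⁻ e
  ... | ab∈ , fines with ∧⁻ ab∈ | ∧⁻ fines
  ...   | a∈ , b∈ | fab , fba = unique-⊆-length {xs = U ∷ ⁅ a ⁆ ∷ ⁅ b ⁆ ∷ []}
    (((λ eq → a≢b (sym (x∈⁅y⁆⇒x≡y a (subst (b ∈_) eq b∈U)))) ∷
      (λ eq → a≢b (x∈⁅y⁆⇒x≡y b (subst (a ∈_) eq a∈U))) ∷ []) ∷
     ((λ eq → a≢b (x∈⁅y⁆⇒x≡y b (subst (a ∈_) eq (x∈⁅x⁆ a)))) ∷ []) ∷ [] ∷ [])
    (λ { (here refl) → ∈-filter-all (Eᵇ F U X) (U∈E F gen a b U U≡ X∩U FU)
       ; (there (here refl)) → ∈-filter-all (Eᵇ F U X) (b∈E F gen b a U U≡′ X∩U fba (does⁻ (a ∈? _) a∈))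
       ; (there (there (here refl))) → ∈-filter-all (Eᵇ F U X) (b∈E F gen a b U U≡ X∩U fab (does⁻ (b ∈? _) b∈)) })

  1≤Ecard : ∀ {X} → (∀ {v} → v ∈ X → v ∉ U) → 1 ≤ Ecard F U X
  1≤Ecard {X} X∩U = unique-⊆-length {xs = [ U ]} ([] ∷ [])
    (λ { (here refl) → ∈-filter-all (Eᵇ F U X) (U∈E F gen a b U U≡ X∩U FU) })

  Ecard-bound : ∀ {X} → (∀ {v} → v ∈ X → v ∉ U) → 2 + 𝟙 (good F a b U X) ≤ Ecard F U X + 𝟙 (bad F a b U X)
  Ecard-bound {X} X∩U with good F a b U X in gX
  ... | true = ≤-trans (3≤Ecard X∩U gX) (m≤m+n _ _)
  ... | false with allFine F U a b X in fab | allFine F U b a X in fba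
  ...   | true | _ = ≤-trans (2≤Ecard F gen a b U U≡ X∩U FU a≢b fab) (m≤m+n _ _)
  ...   | false | true = ≤-trans (2≤Ecard F gen b a U U≡′ X∩U FU (a≢b ∘ sym) fba) (m≤m+n _ _)
  -- `not-allFine` on both sides makes X `bad`, so one element of E(X) suffices.
  ...   | false | false
    rewrite dec-true (a ∈? π F (X ∪ ⁅ a ⁆)) (not-allFine F gen a b U U≡ fab)
          | dec-true (b ∈? π F (X ∪ ⁅ b ⁆)) (not-allFine F gen b a U U≡′ fba) =
    +-monoˡ-≤ 1 (1≤Ecard X∩U)

-- The trace of an extension

module _ {n : ℕ} (F′ : Fam n) (U : Subset n) where

  trace⁻ : ∀ {X} → (F′ ∖F U) X ≡ true → ∃[ Z ] F′ Z ≡ true × X ≡ Z ─ U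
  trace⁻ {X} GX with any⁻ (λ Z → X == (Z ─ U)) (members F′) GX
  ... | Z , Z∈ , X== = Z , proj₂ (filterB⁻ F′ (allSubsets n) Z∈) , does⁻ (X ==? (Z ─ U)) X==

  trace-disjoint : ∀ {X} → (F′ ∖F U) X ≡ true → ∀ {v} → v ∈ X → v ∉ U
  trace-disjoint {X} GX v∈ with trace⁻ {X} GX
  ... | Z , _ , refl = proj₂ (∈-─⁻ Z U v∈)

module _ {n : ℕ} (F : Fam n) (uc : UnionClosed F) (U : Subset n) (F′ : Fam n) (ext : IsExtension F U F′) where

  -- The part coming from F absorbs e, as (A ∪ B) ∪ e = (A ∪ e) ∪ B.
  extension-∪ : ∀ X e → F′ X ≡ true → F e ≡ true → F′ (X ∪ e) ≡ true
  extension-∪ X e F′X Fe with proj₂ ext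
  ... | H , _ , _ , _ , F′≡ with any⁻ _ (members F) (trans (sym (F′≡ X)) F′X)
  ...   | A , A∈ , inner with any⁻ _ (members H) inner
  ...     | B , B∈ , X== with does⁻ (X ==? (A ∪ B)) X==
  ...       | refl = trans (F′≡ _) (any⁺ _ (∈-filter-all F (uc A e (proj₂ (filterB⁻ F (allSubsets n) A∈)) Fe))
    (any⁺ (λ B′ → ((A ∪ B) ∪ e) == ((A ∪ e) ∪ B′)) B∈ (dec-true (_ ==? _) shuffle)))
    where
    open ≡-Reasoning
    shuffle : (A ∪ B) ∪ e ≡ (A ∪ e) ∪ B
    shuffle = begin
      (A ∪ B) ∪ e  ≡⟨ ∪-assoc A B e ⟩
      A ∪ (B ∪ e)  ≡⟨ cong (A ∪_) (∪-comm B e) ⟩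
      A ∪ (e ∪ B)  ≡⟨ ∪-assoc A e B ⟨
      (A ∪ e) ∪ B  ∎

  -- Lift X to a member Z of F′ and adjoin the edge {x, z}; x already lies in X, so the trace gains
  -- at most z.
  trace-closed : ∀ X x z → x ∈ X → z ∉ U → adj F x z ≡ true → (F′ ∖F U) X ≡ true → (F′ ∖F U) (X ∪ ⁅ z ⁆) ≡ true
  trace-closed X x z x∈X z∉U xz GX with trace⁻ F′ U {X} GX
  ... | Z , F′Z , refl = any⁺ (λ Y → (X ∪ ⁅ z ⁆) == (Y ─ U)) (∈-filter-all F′ (extension-∪ Z e F′Z xz))
    (dec-true (_ ==? _) (⊆-antisym sub₁ sub₂))
    where
    e = ⁅ x ⁆ ∪ ⁅ z ⁆
    sub₁ : (Z ─ U) ∪ ⁅ z ⁆ ⊆ (Z ∪ e) ─ U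
    sub₁ v∈ with x∈p∪q⁻ (Z ─ U) ⁅ z ⁆ v∈
    ... | inj₁ v∈ZU = let v∈Z , v∉U = ∈-─⁻ Z U v∈ZU in x∈p∧x∉q⇒x∈p─q (p⊆p∪q e v∈Z) v∉U
    ... | inj₂ v∈z with refl ← x∈⁅y⁆⇒x≡y z v∈z = x∈p∧x∉q⇒x∈p─q (q⊆p∪q Z e (∈-pairʳ x z)) z∉U
    sub₂ : (Z ∪ e) ─ U ⊆ (Z ─ U) ∪ ⁅ z ⁆
    sub₂ v∈ with ∈-─⁻ (Z ∪ e) U v∈
    ... | v∈Ze , v∉U with x∈p∪q⁻ Z e v∈Ze
    ...   | inj₁ v∈Z = p⊆p∪q ⁅ z ⁆ (x∈p∧x∉q⇒x∈p─q v∈Z v∉U)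
    ...   | inj₂ v∈e with ∈-pair⁻ v∈e
    ...     | inj₁ refl = p⊆p∪q ⁅ z ⁆ x∈X
    ...     | inj₂ refl = q⊆p∪q (Z ─ U) ⁅ z ⁆ (x∈⁅x⁆ z)

-- Combining the two covering bounds.

half-fine : ∀ p q m f g → (2 ^ q ∸ 1) ^ p * m ≤ (2 ^ q) ^ p * f → (2 ^ p ∸ 1) ^ q * m ≤ (2 ^ p) ^ q * g → m ≤ f + g
-- T = 2^(pq) is the common denominator of the bounds f ≥ (1 - 2^-q)^p m and g ≥ (1 - 2^-p)^q m,
-- whose coefficients add up to at least 1.
half-fine p q m f g hf hg = *-cancelˡ-≤ T {{m^n≢0 (2 ^ p) q {{m^n≢0 2 p}}}} (begin
  T * m                                          ≤⟨ *-monoˡ-≤ m (2^pq≤[2^q-1]^p+[2^p-1]^q p q) ⟩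
  ((2 ^ q ∸ 1) ^ p + (2 ^ p ∸ 1) ^ q) * m        ≡⟨ *-distribʳ-+ m ((2 ^ q ∸ 1) ^ p) _ ⟩
  (2 ^ q ∸ 1) ^ p * m + (2 ^ p ∸ 1) ^ q * m      ≤⟨ +-mono-≤ hf hg ⟩
  (2 ^ q) ^ p * f + T * g                        ≡⟨ cong (λ t → t * f + T * g) (^-swap 2 q p) ⟩
  T * f + T * g                                  ≡⟨ *-distribˡ-+ T f g ⟨
  T * (f + g)                                    ∎)
  where
  open ≤-Reasoning
  T = (2 ^ p) ^ q

theorem3p29 : (n : ℕ) (F : Fam n) (a b : Fin n) (U : Subset n) →
    UnionClosed F → F ⊥ ≡ true →
    (∀ V → J F V ≡ true → ∣ V ∣ ≡ 1 ⊎ ∣ V ∣ ≡ 2) →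
    U ≡ ⁅ a ⁆ ∪ ⁅ b ⁆ → a ≢ b → J F U ≡ true →
    (∀ X → F X ≡ N³ F U X) →
    (∀ V → J′ F V ≡ true → Nonempty (V ∩ U) → deg (J′ F) U ≤ deg (J′ F) V) →
    (F′ : Fam n) → IsExtension F U F′ →
    2 * μden F F′ U ≤ μnum F F′ U
theorem3p29 n F a b U uc _ small U≡ a≢b JU F≡N³ degrees F′ ext = +-cancelʳ-≤ (count g Gs) _ _ (begin
  -- The number of `good` sets is added to both sides, so that the deficit of the `bad` ones can be
  -- charged to it without subtraction.
  2 * length Gs + count g Gs           ≤⟨ +-monoʳ-≤ (2 * length Gs) (≤-reflexive (count≡sum g Gs)) ⟩
  2 * length Gs + sum (map (𝟙 ∘ g) Gs) ≡⟨ cong (_+ sum (map (𝟙 ∘ g) Gs)) (sum-const Gs) ⟨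
  sum (map (λ _ → 2) Gs) + sum (map (𝟙 ∘ g) Gs)  ≡⟨ sum-map-+ (λ _ → 2) (𝟙 ∘ g) Gs ⟩
  sum (map (λ X → 2 + 𝟙 (g X)) Gs)     ≤⟨ sum-map-mono _ _ Gs (λ X X∈ →
      Ecard-bound F gen a b U U≡ a≢b FU (trace-disjoint F′ U (proj₂ (filterB⁻ G (allSubsets n) X∈)))) ⟩
  sum (map (λ X → Ecard F U X + 𝟙 (h X)) Gs)  ≡⟨ sum-map-+ (Ecard F U) (𝟙 ∘ h) Gs ⟨
  μnum F F′ U + sum (map (𝟙 ∘ h) Gs)   ≡⟨ cong (μnum F F′ U +_) (count≡sum h Gs) ⟨
  μnum F F′ U + count h Gs             ≤⟨ +-monoʳ-≤ (μnum F F′ U) bad≤good ⟩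
  μnum F F′ U + count g Gs             ∎)
  where
  open ≤-Reasoning
  FU = J⇒F F {U} JU
  gen = N-edges F small (⋃F (N F U)) F≡N³
  G = F′ ∖F U
  Gs = members G
  g = good F a b U
  h = bad F a b U
  U≡′ = trans U≡ (∪-comm ⁅ a ⁆ ⁅ b ⁆)

  sum-const : ∀ {A : Set} (xs : List A) → sum (map (λ _ → 2) xs) ≡ 2 * length xs
  sum-const [] = refl
  sum-const (x ∷ xs) = trans (cong (2 +_) (sum-const xs)) (sym (*-suc 2 (length xs)))

  M fab fba : Subset n → Bool
  M X = G X ∧ bothCovered F a b X
  fab = allFine F U a b
  fba = allFine F U b a

  M-closed : ∀ X x z → x ∈ X → z ∉ U → adj F x z ≡ true → M X ≡ true → M (X ∪ ⁅ z ⁆) ≡ true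
  M-closed X x z x∈X z∉U xz MX with ∧⁻ {G X} MX
  ... | GX , cX = ∧⁺ (trace-closed F uc U F′ ext X x z x∈X z∉U xz GX)
                     (bothCovered-mono F a b (p⊆p∪q ⁅ z ⁆) cX)

  p = # (edges-missing F a b)
  q = # (edges-missing F b a)

  half : # M ≤ # (λ X → M X ∧ fab X) + # (λ X → M X ∧ fba X)
  -- On the side of a there are at most p vertices with at least q outer neighbours each; on the
  -- side of b, p and q are exchanged.
  half = half-fine p q (# M) _ _
    (closed-fine F U a b M p q (length-private F small a b U U≡ a≢b)
      (λ x x∈ → edges-missing≤nbrs F small a b U U≡ a≢b (degrees _) gen x∈) M-closed)
    (closed-fine F U b a M q p (length-private F small b a U U≡′ (a≢b ∘ sym))
      (λ x x∈ → edges-missing≤nbrs F small b a U U≡′ (a≢b ∘ sym) (degrees _) gen x∈) M-closed)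

  count-members : ∀ f → count f Gs ≡ # (λ X → G X ∧ f X)
  count-members f = cong length (filterB-filterB G f (allSubsets n))

  bad≤good : count h Gs ≤ count g Gs
  bad≤good = begin
    count h Gs                    ≡⟨ count-members h ⟩
    # (λ X → G X ∧ h X)           ≤⟨ count-mono _ _ (allSubsets n) (λ X → trans (∧-assoc (G X) _ _)) ⟩
    # (λ X → M X ∧ (not (fab X) ∧ not (fba X)))  ≤⟨ #-both-fail M fab fba half ⟩
    # (λ X → M X ∧ (fab X ∧ fba X))  ≤⟨ count-mono _ _ (allSubsets n) (λ X → trans (sym (∧-assoc (G X) _ _))) ⟩
    # (λ X → G X ∧ g X)           ≡⟨ count-members g ⟨
    count g Gs                    ∎
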